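{- $F_v(3,3;J_4)\le 135$; that is, there exists a $J_4$-free graph on $135$ vertices such that every coloring of its vertices with two colors contains a monochromatic triangle.
   Context: All graphs are finite, simple and undirected. $J_4$ denotes the complete graph $K_4$ with one edge removed. A graph $G$ is $H$-free if it contains no subgraph (not necessarily induced) isomorphic to $H$. $F_v(3,3;J_4)$ is the minimum number of vertices of a $J_4$-free graph $G$ such that every $2$-coloring of $V(G)$ yields a monochromatic triangle. -}

module Defs where

open import Data.Nat using (ℕ)
open import Data.Fin using (Fin)
open import Data.Bool using (Bool; true; false)
open import Data.Product using (Σ; ∃; _×_; _,_)
open import Relation.Binary.PropositionalEquality using (_≡_; _≢_)
open import Relation.Nullary using (¬_)

record Graph (n : ℕ) : Set where
  field
    adj   : Fin n → Fin n → Bool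
    sym   : ∀ u v → adj u v ≡ adj v u
    irrefl : ∀ v → adj v v ≡ false

open Graph public

Edge : ∀ {n} → Graph n → Fin n → Fin n → Set
Edge G u v = adj G u v ≡ true

-- G contains J₄ = K₄ minus one edge as a (not necessarily induced) subgraph:
-- four distinct vertices a b c d with all edges among them except possibly cd.
ContainsJ4 : ∀ {n} → Graph n → Set
ContainsJ4 {n} G =
  Σ (Fin n) λ a → Σ (Fin n) λ b → Σ (Fin n) λ c → Σ (Fin n) λ d →
    (a ≢ b) × (a ≢ c) × (a ≢ d) × (b ≢ c) × (b ≢ d) × (c ≢ d) ×
    Edge G a b × Edge G a c × Edge G a d × Edge G b c × Edge G b d

J4Free : ∀ {n} → Graph n → Set
J4Free G = ¬ ContainsJ4 G

Colouring : ℕ → Set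
Colouring n = Fin n → Bool

MonoTriangle : ∀ {n} → Graph n → Colouring n → Set
MonoTriangle {n} G χ =
  Σ (Fin n) λ x → Σ (Fin n) λ y → Σ (Fin n) λ z →
    Edge G x y × Edge G y z × Edge G x z ×
    (χ x ≡ χ y) × (χ y ≡ χ z)

VertexArrows33 : ∀ {n} → Graph n → Set
VertexArrows33 G = ∀ χ → MonoTriangle G χ

-- Let G join two vertices of the Biggs–Smith graph whose distance is 2 or 7.  Every edge of G lies in
-- exactly one triangle, so G is J₄-free.  A 2-colouring is a vector x with entries ±1, and a triangle
-- abc is monochromatic unless (xₐ + x_b + x_c)² = 1.  Weight the triangles with side 2 and side 7 by
-- suitable w₂ and w₇.  The form Σ_T w_T (xₐ + x_b + x_c)² has its least eigenvalue on the 102 vertices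
-- larger than Σ_T w_T / 102, so it exceeds Σ_T w_T at every x, and some triangle is monochromatic.
-- The eigenvalue bound is certified by an integer matrix B for which Σ_T w_T (xₐ + x_b + x_c)² − |Bx|²
-- is nearly diagonal.

module Submission where

open import Defs hiding (sym)
open import Data.Bool using (Bool; true; false; _∧_; _∨_)
open import Data.Bool.Properties using (∧-comm; _≟_)
open import Data.Fin using (Fin; toℕ)
open import Data.Fin.Properties using (all?)
open import Data.Integer using (ℤ; +_; +[1+_]; -[1+_]; -_; _+_; _*_; _≤_; _<_; ∣_∣; 0ℤ; 1ℤ; -1ℤ; +≤+)
open import Data.Integer.Properties hiding (_≟_)
open import Data.Integer.Solver using (module +-*-Solver)
open import Data.List using (List; []; _∷_; _++_; map; concatMap; filter; foldr; length; allFin; upTo)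
open import Data.List.Membership.Propositional using (_∈_)
open import Data.List.Membership.Propositional.Properties using (∈-filter⁺; ∈-allFin)
open import Data.List.Relation.Unary.All as All using (All; []; _∷_; decide)
open import Data.List.Relation.Unary.Any using (Any; here; there)
open import Data.Nat as ℕ using (ℕ; zero; suc; z≤n; s≤s; _≡ᵇ_; _/_; _%_)
open import Data.Nat.DivMod using (_mod_)
import Data.Nat.Properties as ℕ
open import Data.Product using (Σ; _×_; _,_)
open import Data.Sum using (_⊎_; inj₁; inj₂; swap)
open import Data.Vec as Vec using (Vec; []; _∷_; lookup; tabulate; replicate; zipWith; _[_]≔_)
open import Data.Vec.Properties using (lookup-map; lookup∘tabulate)
open import Relation.Binary.PropositionalEquality using (_≡_; refl; sym; trans; cong)
open import Relation.Nullary using (Dec; contradiction)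
open import Relation.Nullary.Decidable using (toWitness; _×-dec_)

variable
  n : ℕ

-- Integer vectors and their inner product.

infix 8 _·_

_·_ : Vec ℤ n → Vec ℤ n → ℤ
[]       · []       = 0ℤ
(c ∷ cs) · (x ∷ xs) = c * x + cs · xs

zipWith-· : ∀ k (c r x : Vec ℤ n) → zipWith (λ a b → k * a + b) c r · x ≡ k * (c · x) + r · x
zipWith-· k []       []       []       = sym (trans (+-identityʳ _) (*-zeroʳ k))
zipWith-· k (c ∷ cs) (r ∷ rs) (x ∷ xs) rewrite zipWith-· k cs rs xs = regroup k c r x (cs · xs) (rs · xs)
  where
  open +-*-Solver
  regroup : ∀ k c r x s t → (k * c + r) * x + (k * s + t) ≡ k * (c * x + s) + (r * x + t)
  regroup = solve 6 (λ k c r x s t →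
    (k :* c :+ r) :* x :+ (k :* s :+ t) := k :* (c :* x :+ s) :+ (r :* x :+ t)) refl

-- The separate zero case keeps sparse rows cheap when the certificate is evaluated.
scaleAdd : ℤ → Vec ℤ n → Vec ℤ n → Vec ℤ n
scaleAdd (+ 0) c r = r
scaleAdd k     c r = zipWith (λ a b → k * a + b) c r

scaleAdd-· : ∀ k (c r x : Vec ℤ n) → scaleAdd k c r · x ≡ k * (c · x) + r · x
scaleAdd-· (+ 0)    c r x = sym (+-identityˡ (r · x))
scaleAdd-· +[1+ m ] c r x = zipWith-· +[1+ m ] c r x
scaleAdd-· -[1+ m ] c r x = zipWith-· -[1+ m ] c r x

zeros : Vec ℤ n
zeros = replicate _ 0ℤ

zeros-· : (x : Vec ℤ n) → zeros · x ≡ 0ℤ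
zeros-· []       = refl
zeros-· (x ∷ xs) = trans (+-identityˡ _) (zeros-· xs)

unit : Fin n → Vec ℤ n
unit i = zeros [ i ]≔ 1ℤ

unit-· : (i : Fin n) (x : Vec ℤ n) → unit i · x ≡ lookup x i
unit-· Fin.zero    (x ∷ xs) rewrite zeros-· xs = trans (+-identityʳ _) (*-identityˡ x)
unit-· (Fin.suc i) (x ∷ xs) = trans (+-identityˡ _) (unit-· i xs)

-- Integer quadratic forms.

-- form d r F stands for d x₀² + 2 x₀ (r · x) + F x in the variables x₀ ∷ x.
data Form : ℕ → Set where
  []   : Form 0
  form : ℤ → Vec ℤ n → Form n → Form (suc n)

eval : Form n → Vec ℤ n → ℤ
eval []           []       = 0ℤ
eval (form d r F) (x ∷ xs) = d * (x * x) + + 2 * (x * (r · xs)) + eval F xs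

zeroForm : Form n
zeroForm {zero}  = []
zeroForm {suc n} = form 0ℤ zeros zeroForm

eval-zeroForm : (x : Vec ℤ n) → eval zeroForm x ≡ 0ℤ
eval-zeroForm []       = refl
eval-zeroForm (x ∷ xs) rewrite zeros-· xs | *-zeroʳ x | eval-zeroForm xs = refl

-- In k (c x₀ + s)², the diagonal gains k c², the cross terms gain k c times the rest of the vector,
-- and k s² is left to the remaining variables.
addSquare : ℤ → Vec ℤ n → Form n → Form n
addSquare k []       []           = []
addSquare k (c ∷ cs) (form d r F) =
  form (k * c * c + d) (scaleAdd (k * c) cs r) (addSquare k cs F)

eval-addSquare : ∀ k (c : Vec ℤ n) F x → eval (addSquare k c F) x ≡ k * (c · x * c · x) + eval F x
eval-addSquare k []       []           []       = sym (trans (+-identityʳ _) (*-zeroʳ k))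
eval-addSquare k (c ∷ cs) (form d r F) (x ∷ xs)
  rewrite scaleAdd-· (k * c) cs r xs | eval-addSquare k cs F xs
  = regroup k c d x (cs · xs) (r · xs) (eval F xs)
  where
  open +-*-Solver
  regroup : ∀ k c d x s t e →
    (k * c * c + d) * (x * x) + + 2 * (x * (k * c * s + t)) + (k * (s * s) + e)
      ≡ k * ((c * x + s) * (c * x + s)) + (d * (x * x) + + 2 * (x * t) + e)
  regroup = solve 7 (λ k c d x s t e →
    (k :* c :* c :+ d) :* (x :* x) :+ con (+ 2) :* (x :* (k :* c :* s :+ t)) :+ (k :* (s :* s) :+ e)
      := k :* ((c :* x :+ s) :* (c :* x :+ s)) :+ (d :* (x :* x) :+ con (+ 2) :* (x :* t) :+ e)) refl

-- Bounds on the values of forms.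

sign : Bool → ℤ
sign true  = 1ℤ
sign false = -1ℤ

∣i*sign∣ : ∀ i b → ∣ i * sign b ∣ ≡ ∣ i ∣
∣i*sign∣ i true  = cong ∣_∣ (*-identityʳ i)
∣i*sign∣ i false = trans (abs-* i -1ℤ) (ℕ.*-identityʳ ∣ i ∣)

norm : Vec ℤ n → ℕ
norm []       = 0
norm (c ∷ cs) = ∣ c ∣ ℕ.+ norm cs

∣·signs∣≤norm : (c : Vec ℤ n) (bs : Vec Bool n) → ∣ c · Vec.map sign bs ∣ ℕ.≤ norm c
∣·signs∣≤norm []       []       = z≤n
∣·signs∣≤norm (c ∷ cs) (b ∷ bs) = ℕ.≤-trans
  (∣i+j∣≤∣i∣+∣j∣ (c * sign b) (cs · Vec.map sign bs))
  (ℕ.+-mono-≤ (ℕ.≤-reflexive (∣i*sign∣ c b)) (∣·signs∣≤norm cs bs))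

-∣i∣≤i : ∀ i → - (+ ∣ i ∣) ≤ i
-∣i∣≤i (+ n)    = neg-≤-pos
-∣i∣≤i -[1+ n ] = ≤-refl

floor : Form n → ℤ
floor []           = 0ℤ
floor (form d r F) = d + + 2 * - (+ norm r) + floor F

-- For entries ±1 the squares are 1, and each cross term is at least minus the absolute value of its
-- coefficient, as in Gershgorin's bound.
floor≤eval-signs : (F : Form n) (bs : Vec Bool n) → floor F ≤ eval F (Vec.map sign bs)
floor≤eval-signs []           []       = ≤-refl
floor≤eval-signs (form d r F) (b ∷ bs) =
  +-mono-≤ (+-mono-≤ (≤-reflexive (sym (d*sign² b))) (*-monoˡ-≤-nonNeg (+ 2) cross)) (floor≤eval-signs F bs)
  where
  s = r · Vec.map sign bs

  d*sign² : ∀ b → d * (sign b * sign b) ≡ d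
  d*sign² true  = *-identityʳ d
  d*sign² false = *-identityʳ d

  cross : - (+ norm r) ≤ sign b * s
  cross = ≤-trans
    (neg-mono-≤ (+≤+ (ℕ.≤-trans
      (ℕ.≤-reflexive (trans (cong ∣_∣ (*-comm (sign b) s)) (∣i*sign∣ s b)))
      (∣·signs∣≤norm r bs))))
    (-∣i∣≤i (sign b * s))

0≤i*i : ∀ i → 0ℤ ≤ i * i
0≤i*i (+ zero)  = ≤-refl
0≤i*i (+ suc n) = +≤+ z≤n
0≤i*i -[1+ n ]  = +≤+ z≤n

-- For the rows of a matrix B this is the form -|Bx|².
subtractSquares : List (Vec ℤ n) → Form n
subtractSquares = foldr (addSquare -1ℤ) zeroForm

eval-subtractSquares : (cs : List (Vec ℤ n)) (x : Vec ℤ n) → eval (subtractSquares cs) x ≤ 0ℤ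
eval-subtractSquares []       x = ≤-reflexive (eval-zeroForm x)
eval-subtractSquares (c ∷ cs) x rewrite eval-addSquare -1ℤ c (subtractSquares cs) x | -1*i≡-i (c · x * c · x) =
  +-mono-≤ (neg-mono-≤ (0≤i*i (c · x))) (eval-subtractSquares cs x)

-- Colourings as sign vectors.

Triple : ℕ → Set
Triple n = Fin n × Fin n × Fin n

row : Triple n → Vec ℤ n
row (a , b , c) = scaleAdd 1ℤ (unit a) (scaleAdd 1ℤ (unit b) (unit c))

Mono : (Fin n → Bool) → Triple n → Set
Mono χ (a , b , c) = χ a ≡ χ b × χ b ≡ χ c

signs : (Fin n → Bool) → Vec ℤ n
signs χ = Vec.map sign (tabulate χ)

-- A sum of three signs is ±3 if they agree and ±1 otherwise.
mono⊎unit-square : (χ : Fin n → Bool) (t : Triple n) → Mono χ t ⊎ row t · signs χ * row t · signs χ ≡ 1ℤ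
mono⊎unit-square χ (a , b , c)
  rewrite scaleAdd-· 1ℤ (unit a) (scaleAdd 1ℤ (unit b) (unit c)) (signs χ)
        | scaleAdd-· 1ℤ (unit b) (unit c) (signs χ)
        | unit-· a (signs χ) | unit-· b (signs χ) | unit-· c (signs χ)
        | lookup-map a sign (tabulate χ) | lookup-map b sign (tabulate χ) | lookup-map c sign (tabulate χ)
        | lookup∘tabulate χ a | lookup∘tabulate χ b | lookup∘tabulate χ c
  with χ a | χ b | χ c
... | true  | true  | true  = inj₁ (refl , refl)
... | true  | true  | false = inj₂ refl
... | true  | false | true  = inj₂ refl
... | true  | false | false = inj₂ refl
... | false | true  | true  = inj₂ refl
... | false | true  | false = inj₂ refl
... | false | false | true  = inj₂ refl
... | false | false | false = inj₁ (refl , refl)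

addTriples : List (ℤ × Triple n) → Form n → Form n
addTriples ts F = foldr (λ (k , t) → addSquare k (row t)) F ts

weight : List (ℤ × Triple n) → ℤ
weight = foldr (λ (k , _) w → k + w) 0ℤ

eval-addTriples : ∀ (x : Vec ℤ n) F {ts} → All (λ (_ , t) → row t · x * row t · x ≡ 1ℤ) ts →
  eval (addTriples ts F) x ≡ weight ts + eval F x
eval-addTriples x F [] = sym (+-identityˡ _)
eval-addTriples x F {(k , t) ∷ ts} (eq ∷ eqs)
  rewrite eval-addSquare k (row t) (addTriples ts F) x | eq | *-identityʳ k | eval-addTriples x F eqs
  = sym (+-assoc k _ _)

-- Without a monochromatic triple every square equals 1, so the form minus |Bx|² is at most the
-- total weight, against its lower bound `floor`.
mono-triple : (ts : List (ℤ × Triple n)) (cs : List (Vec ℤ n)) →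
  weight ts < floor (addTriples ts (subtractSquares cs)) →
  (χ : Fin n → Bool) → Any (λ (_ , t) → Mono χ t) ts
mono-triple ts cs gap χ with decide (λ (_ , t) → swap (mono⊎unit-square χ t)) ts
... | inj₂ mono = mono
... | inj₁ eqs  = contradiction gap (≤⇒≯ (begin
  floor Φ                                         ≤⟨ floor≤eval-signs Φ (tabulate χ) ⟩
  eval Φ (signs χ)                                ≡⟨ eval-addTriples (signs χ) (subtractSquares cs) eqs ⟩
  weight ts + eval (subtractSquares cs) (signs χ) ≤⟨ +-monoʳ-≤ (weight ts) (eval-subtractSquares cs (signs χ)) ⟩
  weight ts + 0ℤ                                  ≡⟨ +-identityʳ _ ⟩
  weight ts                                       ∎))
  where
  open ≤-Reasoning
  Φ = addTriples ts (subtractSquares cs)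

-- The graph.

at : {A : Set} → A → List A → ℕ → A
at z []       _       = z
at z (x ∷ xs) zero    = x
at z (x ∷ xs) (suc i) = at z xs i

-- The Biggs–Smith graph has a semiregular automorphism of order 17 with six orbits; vertex 17 h + z is
-- element z of orbit h.  Entry k of list h′ in block h is the distance from vertex 17 h to vertex
-- 17 h′ + k.
distances : List (List (List ℕ))
distances =
  ((0 ∷ 1 ∷ 2 ∷ 3 ∷ 4 ∷ 5 ∷ 6 ∷ 7 ∷ 6 ∷ 6 ∷ 7 ∷ 6 ∷ 5 ∷ 4 ∷ 3 ∷ 2 ∷ 1 ∷ [])
   ∷ (2 ∷ 3 ∷ 4 ∷ 4 ∷ 3 ∷ 4 ∷ 5 ∷ 5 ∷ 4 ∷ 4 ∷ 5 ∷ 5 ∷ 4 ∷ 3 ∷ 4 ∷ 4 ∷ 3 ∷ [])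
   ∷ (1 ∷ 2 ∷ 3 ∷ 4 ∷ 4 ∷ 5 ∷ 6 ∷ 6 ∷ 5 ∷ 5 ∷ 6 ∷ 6 ∷ 5 ∷ 4 ∷ 4 ∷ 3 ∷ 2 ∷ [])
   ∷ (2 ∷ 3 ∷ 4 ∷ 5 ∷ 5 ∷ 6 ∷ 7 ∷ 6 ∷ 5 ∷ 5 ∷ 6 ∷ 7 ∷ 6 ∷ 5 ∷ 5 ∷ 4 ∷ 3 ∷ [])
   ∷ (3 ∷ 4 ∷ 4 ∷ 5 ∷ 5 ∷ 6 ∷ 6 ∷ 7 ∷ 6 ∷ 6 ∷ 7 ∷ 6 ∷ 6 ∷ 5 ∷ 5 ∷ 4 ∷ 4 ∷ [])
   ∷ (3 ∷ 4 ∷ 5 ∷ 6 ∷ 6 ∷ 7 ∷ 6 ∷ 5 ∷ 4 ∷ 4 ∷ 5 ∷ 6 ∷ 7 ∷ 6 ∷ 6 ∷ 5 ∷ 4 ∷ []) ∷ [])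
  ∷ ((2 ∷ 3 ∷ 4 ∷ 4 ∷ 3 ∷ 4 ∷ 5 ∷ 5 ∷ 4 ∷ 4 ∷ 5 ∷ 5 ∷ 4 ∷ 3 ∷ 4 ∷ 4 ∷ 3 ∷ [])
   ∷ (0 ∷ 4 ∷ 6 ∷ 5 ∷ 1 ∷ 3 ∷ 7 ∷ 6 ∷ 2 ∷ 2 ∷ 6 ∷ 7 ∷ 3 ∷ 1 ∷ 5 ∷ 6 ∷ 4 ∷ [])
   ∷ (1 ∷ 4 ∷ 5 ∷ 5 ∷ 2 ∷ 4 ∷ 6 ∷ 6 ∷ 3 ∷ 3 ∷ 6 ∷ 6 ∷ 4 ∷ 2 ∷ 5 ∷ 5 ∷ 4 ∷ [])
   ∷ (2 ∷ 5 ∷ 5 ∷ 6 ∷ 3 ∷ 5 ∷ 6 ∷ 7 ∷ 4 ∷ 4 ∷ 7 ∷ 6 ∷ 5 ∷ 3 ∷ 6 ∷ 5 ∷ 5 ∷ [])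
   ∷ (3 ∷ 6 ∷ 4 ∷ 7 ∷ 4 ∷ 6 ∷ 5 ∷ 6 ∷ 5 ∷ 5 ∷ 6 ∷ 5 ∷ 6 ∷ 4 ∷ 7 ∷ 4 ∷ 6 ∷ [])
   ∷ (3 ∷ 5 ∷ 6 ∷ 6 ∷ 4 ∷ 5 ∷ 7 ∷ 6 ∷ 4 ∷ 4 ∷ 6 ∷ 7 ∷ 5 ∷ 4 ∷ 6 ∷ 6 ∷ 5 ∷ []) ∷ [])
  ∷ ((1 ∷ 2 ∷ 3 ∷ 4 ∷ 4 ∷ 5 ∷ 6 ∷ 6 ∷ 5 ∷ 5 ∷ 6 ∷ 6 ∷ 5 ∷ 4 ∷ 4 ∷ 3 ∷ 2 ∷ [])
   ∷ (1 ∷ 4 ∷ 5 ∷ 5 ∷ 2 ∷ 4 ∷ 6 ∷ 6 ∷ 3 ∷ 3 ∷ 6 ∷ 6 ∷ 4 ∷ 2 ∷ 5 ∷ 5 ∷ 4 ∷ [])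
   ∷ (0 ∷ 3 ∷ 4 ∷ 5 ∷ 3 ∷ 5 ∷ 7 ∷ 7 ∷ 4 ∷ 4 ∷ 7 ∷ 7 ∷ 5 ∷ 3 ∷ 5 ∷ 4 ∷ 3 ∷ [])
   ∷ (1 ∷ 4 ∷ 4 ∷ 6 ∷ 4 ∷ 6 ∷ 6 ∷ 6 ∷ 4 ∷ 4 ∷ 6 ∷ 6 ∷ 6 ∷ 4 ∷ 6 ∷ 4 ∷ 4 ∷ [])
   ∷ (2 ∷ 5 ∷ 3 ∷ 6 ∷ 4 ∷ 7 ∷ 5 ∷ 6 ∷ 5 ∷ 5 ∷ 6 ∷ 5 ∷ 7 ∷ 4 ∷ 6 ∷ 3 ∷ 5 ∷ [])
   ∷ (2 ∷ 4 ∷ 5 ∷ 7 ∷ 5 ∷ 6 ∷ 6 ∷ 5 ∷ 3 ∷ 3 ∷ 5 ∷ 6 ∷ 6 ∷ 5 ∷ 7 ∷ 5 ∷ 4 ∷ []) ∷ [])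
  ∷ ((2 ∷ 3 ∷ 4 ∷ 5 ∷ 5 ∷ 6 ∷ 7 ∷ 6 ∷ 5 ∷ 5 ∷ 6 ∷ 7 ∷ 6 ∷ 5 ∷ 5 ∷ 4 ∷ 3 ∷ [])
   ∷ (2 ∷ 5 ∷ 5 ∷ 6 ∷ 3 ∷ 5 ∷ 6 ∷ 7 ∷ 4 ∷ 4 ∷ 7 ∷ 6 ∷ 5 ∷ 3 ∷ 6 ∷ 5 ∷ 5 ∷ [])
   ∷ (1 ∷ 4 ∷ 4 ∷ 6 ∷ 4 ∷ 6 ∷ 6 ∷ 6 ∷ 4 ∷ 4 ∷ 6 ∷ 6 ∷ 6 ∷ 4 ∷ 6 ∷ 4 ∷ 4 ∷ [])
   ∷ (0 ∷ 4 ∷ 3 ∷ 7 ∷ 4 ∷ 7 ∷ 5 ∷ 5 ∷ 3 ∷ 3 ∷ 5 ∷ 5 ∷ 7 ∷ 4 ∷ 7 ∷ 3 ∷ 4 ∷ [])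
   ∷ (1 ∷ 5 ∷ 2 ∷ 6 ∷ 3 ∷ 6 ∷ 4 ∷ 5 ∷ 4 ∷ 4 ∷ 5 ∷ 4 ∷ 6 ∷ 3 ∷ 6 ∷ 2 ∷ 5 ∷ [])
   ∷ (1 ∷ 3 ∷ 4 ∷ 6 ∷ 5 ∷ 6 ∷ 5 ∷ 4 ∷ 2 ∷ 2 ∷ 4 ∷ 5 ∷ 6 ∷ 5 ∷ 6 ∷ 4 ∷ 3 ∷ []) ∷ [])
  ∷ ((3 ∷ 4 ∷ 4 ∷ 5 ∷ 5 ∷ 6 ∷ 6 ∷ 7 ∷ 6 ∷ 6 ∷ 7 ∷ 6 ∷ 6 ∷ 5 ∷ 5 ∷ 4 ∷ 4 ∷ [])
   ∷ (3 ∷ 6 ∷ 4 ∷ 7 ∷ 4 ∷ 6 ∷ 5 ∷ 6 ∷ 5 ∷ 5 ∷ 6 ∷ 5 ∷ 6 ∷ 4 ∷ 7 ∷ 4 ∷ 6 ∷ [])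
   ∷ (2 ∷ 5 ∷ 3 ∷ 6 ∷ 4 ∷ 7 ∷ 5 ∷ 6 ∷ 5 ∷ 5 ∷ 6 ∷ 5 ∷ 7 ∷ 4 ∷ 6 ∷ 3 ∷ 5 ∷ [])
   ∷ (1 ∷ 5 ∷ 2 ∷ 6 ∷ 3 ∷ 6 ∷ 4 ∷ 5 ∷ 4 ∷ 4 ∷ 5 ∷ 4 ∷ 6 ∷ 3 ∷ 6 ∷ 2 ∷ 5 ∷ [])
   ∷ (0 ∷ 6 ∷ 1 ∷ 7 ∷ 2 ∷ 6 ∷ 3 ∷ 5 ∷ 4 ∷ 4 ∷ 5 ∷ 3 ∷ 6 ∷ 2 ∷ 7 ∷ 1 ∷ 6 ∷ [])
   ∷ (2 ∷ 4 ∷ 3 ∷ 5 ∷ 4 ∷ 5 ∷ 4 ∷ 4 ∷ 3 ∷ 3 ∷ 4 ∷ 4 ∷ 5 ∷ 4 ∷ 5 ∷ 3 ∷ 4 ∷ []) ∷ [])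
  ∷ ((3 ∷ 4 ∷ 5 ∷ 6 ∷ 6 ∷ 7 ∷ 6 ∷ 5 ∷ 4 ∷ 4 ∷ 5 ∷ 6 ∷ 7 ∷ 6 ∷ 6 ∷ 5 ∷ 4 ∷ [])
   ∷ (3 ∷ 5 ∷ 6 ∷ 6 ∷ 4 ∷ 5 ∷ 7 ∷ 6 ∷ 4 ∷ 4 ∷ 6 ∷ 7 ∷ 5 ∷ 4 ∷ 6 ∷ 6 ∷ 5 ∷ [])
   ∷ (2 ∷ 4 ∷ 5 ∷ 7 ∷ 5 ∷ 6 ∷ 6 ∷ 5 ∷ 3 ∷ 3 ∷ 5 ∷ 6 ∷ 6 ∷ 5 ∷ 7 ∷ 5 ∷ 4 ∷ [])
   ∷ (1 ∷ 3 ∷ 4 ∷ 6 ∷ 5 ∷ 6 ∷ 5 ∷ 4 ∷ 2 ∷ 2 ∷ 4 ∷ 5 ∷ 6 ∷ 5 ∷ 6 ∷ 4 ∷ 3 ∷ [])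
   ∷ (2 ∷ 4 ∷ 3 ∷ 5 ∷ 4 ∷ 5 ∷ 4 ∷ 4 ∷ 3 ∷ 3 ∷ 4 ∷ 4 ∷ 5 ∷ 4 ∷ 5 ∷ 3 ∷ 4 ∷ [])
   ∷ (0 ∷ 2 ∷ 4 ∷ 6 ∷ 6 ∷ 7 ∷ 5 ∷ 3 ∷ 1 ∷ 1 ∷ 3 ∷ 5 ∷ 7 ∷ 6 ∷ 6 ∷ 4 ∷ 2 ∷ []) ∷ []) ∷ []

-- The 33 vertices from 102 on get distance 8 from everything, which makes them isolated in G.
distance : ℕ → ℕ → ℕ
distance u v = at 8 (at [] (at [] distances (u / 17)) (v / 17)) ((v % 17 ℕ.+ (17 ℕ.∸ u % 17)) % 17)

near : ℕ → ℕ → Bool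
near u v = let d = distance u v in (d ≡ᵇ 2) ∨ (d ≡ᵇ 7)

-- distance is symmetric; the conjunction makes this evident for adjacent.
adjacent : Fin 135 → Fin 135 → Bool
adjacent u v = near (toℕ u) (toℕ v) ∧ near (toℕ v) (toℕ u)

G : Graph 135
G = record
  { adj    = adjacent
  ; sym    = λ u v → ∧-comm (near (toℕ u) (toℕ v)) (near (toℕ v) (toℕ u))
  ; irrefl = toWitness {a? = all? λ v → adjacent v v ≟ false} _
  }

-- J₄-freeness.

adjacent? : ∀ u v → Dec (Edge G u v)
adjacent? u v = adjacent u v ≟ true

neighbours : Fin 135 → List (Fin 135)
neighbours u = filter (adjacent? u) (allFin 135)

neighbours⁺ : ∀ u v → Edge G u v → v ∈ neighbours u
neighbours⁺ u v = ∈-filter⁺ (adjacent? u) (∈-allFin v)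

-- With `N` the neighbourhood of u, the filtered list holds the common neighbours of u and `v`, so
-- an edge uv lies in at most one triangle.
AtMostOneCommon : List (Fin 135) → Fin 135 → Set
AtMostOneCommon N v = length (filter (adjacent? v) N) ℕ.≤ 1

-- A function of N, so that the list of neighbours is evaluated only once.
atMostOneCommon? : ∀ N → Dec (All (AtMostOneCommon N) N)
atMostOneCommon? N = All.all? (λ _ → _ ℕ.≤? 1) N

atMostOneCommon : ∀ u → All (AtMostOneCommon (neighbours u)) (neighbours u)
atMostOneCommon = toWitness {a? = all? λ u → atMostOneCommon? (neighbours u)} _

∈-unique : {A : Set} {xs : List A} {x y : A} → length xs ℕ.≤ 1 → x ∈ xs → y ∈ xs → x ≡ y
∈-unique {xs = _ ∷ []}    _        (here refl) (here refl) = refl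
∈-unique {xs = _ ∷ _ ∷ _} (s≤s ())

-- In a J₄, both c and d are common neighbours of the ends of the edge ab.
G-J4Free : J4Free G
G-J4Free (a , b , c , d , _ , _ , _ , _ , _ , c≢d , ab , ac , ad , bc , bd) =
  c≢d (∈-unique (All.lookup (atMostOneCommon a) (neighbours⁺ a b ab)) (common c ac bc) (common d ad bd))
  where
  common : ∀ v → Edge G a v → Edge G b v → v ∈ filter (adjacent? b) (neighbours a)
  common v av bv = ∈-filter⁺ (adjacent? b) (neighbours⁺ a v av) bv

-- The eigenvalue certificate.

-- Triangles of G up to rotation, first those with side 2 and then those with side 7.
orbitRepresentatives : List (ℤ × ℕ × ℕ × ℕ)
orbitRepresentatives =
  map (+ 341398 ,_)
    ((0 , 2 , 35) ∷ (0 , 17 , 51) ∷ (17 , 25 , 38) ∷ (34 , 68 , 85) ∷ (51 , 70 , 83) ∷ (51 , 93 , 94) ∷ [])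
  ++
  map (+ 300000 ,_)
    ((0 , 7 , 97) ∷ (0 , 57 , 62) ∷ (0 , 75 , 78) ∷ (17 , 23 , 71) ∷ (17 , 58 , 61) ∷ (17 , 91 , 96)
      ∷ (34 , 40 , 88) ∷ (34 , 41 , 80) ∷ [])

-- Shifts within an orbit. Vertices below 102 stay below 102, so `mod 135` only casts to `Fin`.
rotate : ℕ → ℕ → Fin 135
rotate s v = (17 ℕ.* (v / 17) ℕ.+ (v % 17 ℕ.+ s) % 17) mod 135

triangles : List (ℤ × Triple 135)
triangles = concatMap
  (λ (k , a , b , c) → map (λ s → k , rotate s a , rotate s b , rotate s c) (upTo 17))
  orbitRepresentatives

-- B takes the value coefficients[k] at pairs at distance k.  It is the rounded square root, within the
-- Bose–Mesner algebra of the Biggs–Smith graph, of the form of the triangles minus a scalar.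
coefficients : List ℤ
coefficients = + 411 ∷ - + 178 ∷ + 214 ∷ - + 91 ∷ - + 109 ∷ + 85 ∷ + 60 ∷ + 187 ∷ []

-- Distance 8 is past the end of `coefficients`, so the entries at isolated vertices default to 0.
squares : List (Vec ℤ 135)
squares = map (λ u → tabulate λ v → at 0ℤ coefficients (distance u (toℕ v))) (upTo 102)

-- Each of the 102 vertices lies in 3 triangles of side 2 and 4 of side 7. The weight is 741398 per
-- vertex and the diagonal entries are 761377, which leaves 19979 per vertex for the off-diagonal
-- entries.
gap : weight triangles < floor (addTriples triangles (subtractSquares squares))
gap = toWitness {a? = _ <? _} _

-- Monochromatic triangles of G.

IsTriangle : Triple 135 → Set
IsTriangle (a , b , c) = Edge G a b × Edge G b c × Edge G a c

isTriangle? : ∀ t → Dec (IsTriangle t)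
isTriangle? (a , b , c) = adjacent? a b ×-dec adjacent? b c ×-dec adjacent? a c

triangles-in-G : All (λ (_ , t) → IsTriangle t) triangles
triangles-in-G = toWitness {a? = All.all? (λ (_ , t) → isTriangle? t) triangles} _

monoTriangle : ∀ χ {ts : List (ℤ × Triple 135)} →
  All (λ (_ , t) → IsTriangle t) ts → Any (λ (_ , t) → Mono χ t) ts → MonoTriangle G χ
monoTriangle χ {(_ , a , b , c) ∷ _} ((ab , bc , ac) ∷ _) (here (χa≡χb , χb≡χc)) =
  a , b , c , ab , bc , ac , χa≡χb , χb≡χc
monoTriangle χ (_ ∷ triangle) (there mono) = monoTriangle χ triangle mono

G-arrows : VertexArrows33 G
G-arrows χ = monoTriangle χ triangles-in-G (mono-triple triangles squares gap χ)

theorem7 : Σ (Graph 135) λ G → J4Free G × VertexArrows33 G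
theorem7 = G , G-J4Free , G-arrows
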